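{- Let $n \ge 5$, let $T$ be a path graph with vertex set $\{1,2,\ldots,n\}$, and let $\Gamma$ be the Cayley graph of $S_n$ generated by the transpositions $(i,j)$ such that $ij$ is an edge of $T$. Then $$\mathrm{diam}(\Gamma) = \max_{\pi \in S_n} \left\{ c(\pi)-n+\sum_{i=1}^n \mathrm{dist}_T(i,\pi(i)) \right\}.$$
   Context: $S_n$ is the symmetric group on $\{1,\ldots,n\}$; the product $\pi\tau$ means apply $\tau$ first, then $\pi$. For a tree $T$ on vertex set $\{1,\ldots,n\}$ (a transposition tree), each edge $ij$ is identified with the transposition $(i,j)$, and the Cayley graph $\Gamma$ generated by $T$ is the simple undirected graph with vertex set $S_n$ in which $g$ and $h$ are adjacent iff $h = gs$ for some transposition $s$ that is an edge of $T$. $\mathrm{dist}_G(u,v)$ denotes the distance between vertices $u,v$ in a graph $G$, and $\mathrm{diam}(G)$ its diameter. $c(\pi)$ is the number of cycles of $\pi$, including cycles of length 1. -}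

module Defs where

open import Data.Fin.Base using (Fin; toℕ; fromℕ<)
open import Data.Fin.Permutation as Perm
  using (Permutation′; _⟨$⟩ʳ_; _∘ₚ_; transpose)
import Data.Fin.Permutation.Components as PC
open import Data.Fin.Properties as Fin using (pigeonhole; any?; toℕ<n; toℕ-fromℕ<)
open import Data.Integer.Base as ℤ using (ℤ)
open import Data.List.Base using (allFin; deduplicate; length)
open import Data.Nat.Base using (ℕ; zero; suc; _+_; _*_; _∸_; _≤_; _<_; NonZero; >-nonZero; s≤s⁻¹)
open import Data.Nat.DivMod using (_/_; _%_; m≡m%n+[m/n]*n; m%n<n)
open import Data.Nat.GeneralisedArithmetic using (fold; fold-+)
open import Data.Nat.Properties
  using (n<1+n; 1+n≢n; <⇒≤; m<n⇒0<n∸m; m+[n∸m]≡n; m∸n≤m; ≤-trans; <-≤-trans)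
open import Data.Product.Base using (_×_; _,_; ∃-syntax)
open import Data.Sum.Base using (_⊎_; inj₁; inj₂)
import Data.Sum.Base as Sum
open import Function.Bundles using (_⇔_; module Injection)
open import Function.Properties.Inverse using (↔⇒↣)
open import Level using (0ℓ)
open import Relation.Binary.Bundles using (Setoid)
open import Relation.Binary.Core using (Rel)
open import Relation.Binary.Definitions
  using (Decidable; Symmetric; Irreflexive; _Respects₂_)
open import Relation.Binary.PropositionalEquality
  using (_≡_; refl; sym; trans; cong; setoid; resp₂)
open import Relation.Nullary.Decidable using (map′; dec-true)

private
  variable
    n : ℕ

-- Vertices are taken from a setoid because two permutations are identified
-- when they agree pointwise.

record SimpleGraph (V : Setoid 0ℓ 0ℓ) : Set₁ where
  open Setoid V using (Carrier; _≈_)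
  field
    Adj        : Rel Carrier 0ℓ
    Adj-resp-≈ : Adj Respects₂ _≈_
    Adj-sym    : Symmetric Adj
    Adj-irrefl : Irreflexive _≈_ Adj

module _ {V : Setoid 0ℓ 0ℓ} (G : SimpleGraph V) where
  open Setoid V using (Carrier; _≈_)
  open SimpleGraph G

  data Walk : ℕ → Rel Carrier 0ℓ where
    stop : ∀ {u v} → u ≈ v → Walk 0 u v
    step : ∀ {k u v w} → Adj u v → Walk k v w → Walk (suc k) u w

  IsDist : Carrier → Carrier → ℕ → Set
  IsDist u v d = Walk d u v × (∀ k → Walk k u v → d ≤ k)

  -- In particular G must be connected.
  IsDiameter : ℕ → Set
  IsDiameter m =
    (∃[ u ] ∃[ v ] IsDist u v m) ×
    (∀ u v → ∃[ d ] IsDist u v d × d ≤ m)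

IsMaximum : {A : Set} → (A → ℤ) → ℤ → Set
IsMaximum f m = (∃[ a ] f a ≡ m) × (∀ a → f a ℤ.≤ m)

Graph : ℕ → Set₁
Graph n = SimpleGraph (setoid (Fin n))

pathGraph : ∀ n → Graph n
pathGraph n = record
  { Adj        = λ i j → toℕ j ≡ suc (toℕ i) ⊎ toℕ i ≡ suc (toℕ j)
  ; Adj-resp-≈ = resp₂ _
  ; Adj-sym    = Sum.swap
  ; Adj-irrefl = λ { refl (inj₁ e) → 1+n≢n (sym e) ; refl (inj₂ e) → 1+n≢n (sym e) }
  }

-- The vertices of the path may occur along it in any order.
IsPath : Graph n → Set
IsPath {n} T = ∃[ σ ] (∀ i j →
  SimpleGraph.Adj T i j ⇔ SimpleGraph.Adj (pathGraph n) (σ ⟨$⟩ʳ i) (σ ⟨$⟩ʳ j))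

-- The library's ∘ₚ applies its left argument first.
infixl 7 _·_

_·_ : Permutation′ n → Permutation′ n → Permutation′ n
π · τ = τ ∘ₚ π

symmetricSetoid : ℕ → Setoid 0ℓ 0ℓ
symmetricSetoid n = record
  { Carrier       = Permutation′ n
  ; _≈_           = Perm._≈_
  ; isEquivalence = record
    { refl  = λ _ → refl
    ; sym   = λ p i → sym (p i)
    ; trans = λ p q i → trans (p i) (q i)
    }
  }

injective : (π : Permutation′ n) → ∀ {i j} → π ⟨$⟩ʳ i ≡ π ⟨$⟩ʳ j → i ≡ j
injective π = Injection.injective (↔⇒↣ π)

transpose-fst : (i j : Fin n) → transpose i j ⟨$⟩ʳ i ≡ j
transpose-fst i j rewrite dec-true (i Fin.≟ i) refl = refl

cayleyGraph : Graph n → SimpleGraph (symmetricSetoid n)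
cayleyGraph {n} T = record
  { Adj        = Adj
  ; Adj-resp-≈ =
      (λ p → λ { (i , j , a , e) → i , j , a , λ x → trans (sym (p x)) (e x) })
    , (λ p → λ { (i , j , a , e) → i , j , a , λ x → trans (e x) (p _) })
  ; Adj-sym    = λ { {g} {h} (i , j , a , e) →
      j , i , T.Adj-sym a ,
      λ x → sym (trans (e _) (cong (g ⟨$⟩ʳ_) (PC.transpose-inverse i j))) }
  ; Adj-irrefl = λ { {g} {h} p (i , j , a , e) →
      T.Adj-irrefl
        (injective g (trans (p i) (trans (e i) (cong (g ⟨$⟩ʳ_) (transpose-fst i j))))) a }
  }
  where
  module T = SimpleGraph T

  Adj : Rel (Permutation′ n) 0ℓ
  Adj g h = ∃[ i ] ∃[ j ] T.Adj i j × h Perm.≈ g · transpose i j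

SameCycle : Permutation′ n → Rel (Fin n) 0ℓ
SameCycle π i j = ∃[ k ] fold i (π ⟨$⟩ʳ_) k ≡ j

module _ (π : Permutation′ n) (i : Fin n) where
  private
    _^_ : Fin n → ℕ → Fin n
    x ^ k = fold x (π ⟨$⟩ʳ_) k

    cancel : ∀ k {x y} → x ^ k ≡ y ^ k → x ≡ y
    cancel zero    e = e
    cancel (suc k) e = cancel k (injective π e)

  period : ∃[ p ] 0 < p × p ≤ n × i ^ p ≡ i
  period with pigeonhole (n<1+n n) (λ a → i ^ toℕ a)
  ... | a , b , a<b , e =
    toℕ b ∸ toℕ a , m<n⇒0<n∸m a<b ,
    ≤-trans (m∸n≤m (toℕ b) (toℕ a)) (s≤s⁻¹ (toℕ<n b)) ,
    cancel (toℕ a) (trans (sym (fold-+ i (π ⟨$⟩ʳ_) (toℕ a)))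
      (trans (cong (i ^_) (m+[n∸m]≡n (<⇒≤ a<b))) (sym e)))

  bounded : ∀ k → ∃[ m ] i ^ toℕ {n} m ≡ i ^ k
  bounded k with period
  ... | p , 0<p , p≤n , e = fromℕ< r<n , trans (cong (i ^_) (toℕ-fromℕ< r<n)) (sym reduce)
    where
    instance
      p≢0 : NonZero p
      p≢0 = >-nonZero 0<p

    r<n : k % p < n
    r<n = <-≤-trans (m%n<n k p) p≤n

    multiple : ∀ q → i ^ (q * p) ≡ i
    multiple zero    = refl
    multiple (suc q) =
      trans (fold-+ i (π ⟨$⟩ʳ_) p) (trans (cong (_^ p) (multiple q)) e)

    reduce : i ^ k ≡ i ^ (k % p)
    reduce = trans (cong (i ^_) (m≡m%n+[m/n]*n k p))
      (trans (fold-+ i (π ⟨$⟩ʳ_) (k % p)) (cong (_^ (k % p)) (multiple (k / p))))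

sameCycle? : (π : Permutation′ n) → Decidable (SameCycle π)
sameCycle? π i j = map′
  (λ { (m , e) → toℕ m , e })
  (λ { (k , e) → let (m , e′) = bounded π i k in m , trans e′ e })
  (any? (λ m → fold i (π ⟨$⟩ʳ_) (toℕ m) Fin.≟ j))

-- One representative is kept from each cycle, fixed points included.
cycleCount : Permutation′ n → ℕ
cycleCount {n} π = length (deduplicate (sameCycle? π) (allFin n))

{-# OPTIONS --safe #-}

-- Both sides equal n(n−1)/2.  The distance between u and v in the Cayley
-- graph is the number of pairs of labels whose positions along the path are
-- ordered differently by u⁻¹ and v⁻¹: a generator changes this number by one,
-- and some generator lowers it unless u = v.  It is largest when v reverses
-- the path and u is the identity.
--
-- For the maximum, let f be the number of fixed points of π and D the total
-- displacement.  Then 2 c(π) ≤ n + f, since i and π(i) are not both chosen as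
-- cycle representatives unless they coincide, and 2 D + f ≤ n², by comparing
-- every position with the centre of the path.  Adding the two cancels f, and
-- both are equalities for the reversal of the path.
module Submission where

open import Defs
open import Data.Nat.Properties using (+-0-commutativeMonoid)
open import Algebra.Properties.CommutativeMonoid.Sum +-0-commutativeMonoid using (sum-syntax)
open import Data.Fin.Base using (Fin)
open import Data.Fin.Permutation using (Permutation′; _⟨$⟩ʳ_)
open import Data.Integer.Base using (+_; _+_; _-_)
open import Data.Nat.Base using (ℕ; _≤_)
open import Data.Product.Base using (_×_; Σ-syntax; ∃-syntax)

open import Algebra.Properties.CommutativeMonoid.Sum +-0-commutativeMonoid
  using (sum-cong-≗; sum-replicate-zero; sum-init-last; ∑-distrib-+; ∑-comm; ∑-permute)
open import Data.Empty using (⊥-elim)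
open import Data.Fin.Base as Fin using (zero; suc; toℕ; fromℕ; fromℕ<; inject₁; opposite)
open import Data.Fin.Induction using (<-weakInduction; >-weakInduction)
open import Data.Fin.Permutation using (_⟨$⟩ˡ_; _∘ₚ_; flip; reverse; transpose; inverseˡ; inverseʳ)
import Data.Fin.Permutation as Perm
import Data.Fin.Permutation.Components as PC
import Data.Fin.Properties as Fin
import Data.Integer.Base as ℤ
import Data.Integer.Properties as ℤ
import Data.Integer.Tactic.RingSolver as ℤ
open import Data.List.Base using (List; []; _∷_; allFin; deduplicate; length)
open import Data.List.Membership.Propositional using (_∈_; find)
open import Data.List.Membership.Propositional.Properties using (∈-allFin; ∈-AllPairs₂)
open import Data.List.Relation.Unary.All using () renaming (lookup to All-lookup)
import Data.List.Relation.Unary.AllPairs as AllPairs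
open AllPairs using (AllPairs; []; _∷_)
open import Data.List.Relation.Unary.Any using (here; there; any?)
import Data.List.Relation.Unary.Any as Any
import Data.List.Relation.Unary.Any.Properties as Any
open import Data.List.Relation.Unary.AllPairs.Properties using (filter⁺)
open import Data.List.Relation.Unary.All.Properties using (all-filter)
open import Data.Nat.Base using (zero; suc; _*_; _∸_; _<_; ∣_-_∣; z≤n; s≤s; s≤s⁻¹)
  renaming (_+_ to infixl 6 _⊕_)
open import Data.Nat.GeneralisedArithmetic using (fold; fold-+)
open import Data.Nat.Properties hiding (+-0-commutativeMonoid)
open import Data.Nat.Tactic.RingSolver using (solve-∀)
open import Data.Product.Base using (_,_)
open import Data.Sum.Base using (_⊎_; inj₁; inj₂)
import Data.Sum.Base as Sum
open import Function.Base using (_∘_; case_of_)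
open import Function.Bundles using (_⇔_; module Equivalence)
open import Function.Definitions using (Injective)
open import Relation.Binary.Definitions using (tri<; tri≈; tri>; Decidable; Transitive)
open import Relation.Binary.PropositionalEquality
open import Relation.Nullary using (¬_; Dec; yes; no)
open import Relation.Nullary.Decidable using (¬?; _×-dec_; dec-true; dec-false)

private
  variable
    n : ℕ
    P Q : Set

-- Indicators and finite sums

χ : Dec P → ℕ
χ (yes _) = 1
χ (no _)  = 0

χ-true : (d : Dec P) → P → χ d ≡ 1
χ-true (yes _) p = refl
χ-true (no ¬p) p = ⊥-elim (¬p p)

χ-false : (d : Dec P) → ¬ P → χ d ≡ 0
χ-false (yes p) ¬p = ⊥-elim (¬p p)
χ-false (no _)  ¬p = refl

χ-mono : (d : Dec P) (e : Dec Q) → (P → Q) → χ d ≤ χ e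
χ-mono (yes p) e f = ≤-reflexive (sym (χ-true e (f p)))
χ-mono (no _)  e f = z≤n

χ-cong : (d : Dec P) (e : Dec Q) → (P → Q) → (Q → P) → χ d ≡ χ e
χ-cong d e f g = ≤-antisym (χ-mono d e f) (χ-mono e d g)

χ≤1 : (d : Dec P) → χ d ≤ 1
χ≤1 (yes _) = ≤-refl
χ≤1 (no _)  = z≤n

∑-mono-≤ : {f g : Fin n → ℕ} → (∀ i → f i ≤ g i) → ∑[ i < n ] f i ≤ ∑[ i < n ] g i
∑-mono-≤ {zero}  f≤g = z≤n
∑-mono-≤ {suc n} f≤g = +-mono-≤ (f≤g zero) (∑-mono-≤ (f≤g ∘ suc))

∑-const : ∀ n c → ∑[ i < n ] c ≡ n * c
∑-const zero    c = refl
∑-const (suc n) c = cong (c ⊕_) (∑-const n c)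

∑-*ˡ : ∀ c (f : Fin n → ℕ) → ∑[ i < n ] (c * f i) ≡ c * ∑[ i < n ] f i
∑-*ˡ {zero}  c f = sym (*-zeroʳ c)
∑-*ˡ {suc n} c f = trans (cong (c * f zero ⊕_) (∑-*ˡ c (f ∘ suc))) (sym (*-distribˡ-+ c (f zero) _))

∑-zero : {f : Fin n → ℕ} → (∀ i → f i ≡ 0) → ∑[ i < n ] f i ≡ 0
∑-zero {n} f≡0 = trans (sum-cong-≗ f≡0) (sum-replicate-zero n)

∑-select : {R : Fin n → Set} (R? : ∀ i → Dec (R i)) (g : Fin n → ℕ) {i₀ : Fin n} →
           R i₀ → (∀ i → R i → i ≡ i₀) → ∑[ i < n ] (χ (R? i) * g i) ≡ g i₀
∑-select {suc n} R? g {zero} r uniq =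
  trans (cong₂ (λ a b → a * g zero ⊕ b) (χ-true (R? zero) r)
          (∑-zero (λ i → cong (_* g (suc i)) (χ-false (R? (suc i)) (Fin.0≢1+n ∘ sym ∘ uniq (suc i))))))
        (trans (+-identityʳ _) (*-identityˡ _))
∑-select {suc n} R? g {suc i₀} r uniq =
  cong₂ (λ a b → a * g zero ⊕ b) (χ-false (R? zero) (Fin.0≢1+n ∘ uniq zero))
    (∑-select (R? ∘ suc) (g ∘ suc) r (λ i → Fin.suc-injective ∘ uniq (suc i)))

∑-count : {R : Fin n → Set} (R? : ∀ i → Dec (R i)) {i₀ : Fin n} →
          R i₀ → (∀ i → R i → i ≡ i₀) → ∑[ i < n ] χ (R? i) ≡ 1
∑-count {n} R? r uniq = trans (sum-cong-≗ {n} (λ i → sym (*-identityʳ (χ (R? i))))) (∑-select R? (λ _ → 1) r uniq)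

∑∑-distrib-+ : (f g : Fin n → Fin n → ℕ) →
  ∑[ i < n ] ∑[ j < n ] (f i j ⊕ g i j) ≡ ∑[ i < n ] ∑[ j < n ] f i j ⊕ ∑[ i < n ] ∑[ j < n ] g i j
∑∑-distrib-+ {n} f g = trans (sum-cong-≗ {n} (λ i → ∑-distrib-+ (f i) (g i))) (∑-distrib-+ {n} _ _)

-- Inversions

pairs : ℕ → ℕ
pairs n = ∑[ i < n ] ∑[ j < n ] χ (toℕ i <? toℕ j)

-- Each of the n² ordered pairs is ascending, descending or diagonal, and exchanging the coordinates
-- matches the first two kinds. So `pairs n` is n(n - 1)/2, put in a form free of division and
-- subtraction.
2*pairs+n≡n² : ∀ n → 2 * pairs n ⊕ n ≡ n * n
2*pairs+n≡n² n = begin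
  2 * pairs n ⊕ n
    ≡⟨ cong₂ _⊕_ (cong (pairs n ⊕_) (trans (+-identityʳ _) (∑-comm {n} {n} (λ i j → χ (toℕ i <? toℕ j))))) (sym diagonal) ⟩
  pairs n ⊕ ∑[ i < n ] ∑[ j < n ] χ (toℕ j <? toℕ i) ⊕ ∑[ i < n ] ∑[ j < n ] χ (i Fin.≟ j)
    ≡⟨ cong (_⊕ ∑[ i < n ] ∑[ j < n ] χ (i Fin.≟ j)) (sym (∑∑-distrib-+ {n} _ _)) ⟩
  ∑[ i < n ] ∑[ j < n ] (χ (toℕ i <? toℕ j) ⊕ χ (toℕ j <? toℕ i)) ⊕ ∑[ i < n ] ∑[ j < n ] χ (i Fin.≟ j)
    ≡⟨ sym (∑∑-distrib-+ {n} _ _) ⟩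
  ∑[ i < n ] ∑[ j < n ] (χ (toℕ i <? toℕ j) ⊕ χ (toℕ j <? toℕ i) ⊕ χ (i Fin.≟ j))
    ≡⟨ sum-cong-≗ (λ i → sum-cong-≗ (trichotomy i)) ⟩
  ∑[ i < n ] ∑[ j < n ] 1
    ≡⟨ sum-cong-≗ {n} (λ i → trans (∑-const n 1) (*-identityʳ n)) ⟩
  ∑[ i < n ] n
    ≡⟨ ∑-const n n ⟩
  n * n ∎
  where
  open ≡-Reasoning
  diagonal : ∑[ i < n ] ∑[ j < n ] χ (i Fin.≟ j) ≡ n
  diagonal = trans (sum-cong-≗ {n} (λ i → ∑-count (i Fin.≟_) refl (λ _ → sym)))
    (trans (∑-const n 1) (*-identityʳ n))

  trichotomy : (i j : Fin n) → χ (toℕ i <? toℕ j) ⊕ χ (toℕ j <? toℕ i) ⊕ χ (i Fin.≟ j) ≡ 1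
  trichotomy i j with <-cmp (toℕ i) (toℕ j)
  ... | tri< a ¬b ¬c rewrite χ-true (toℕ i <? toℕ j) a | χ-false (toℕ j <? toℕ i) ¬c
                           | χ-false (i Fin.≟ j) (¬b ∘ cong toℕ) = refl
  ... | tri≈ ¬a b ¬c rewrite χ-false (toℕ i <? toℕ j) ¬a | χ-false (toℕ j <? toℕ i) ¬c
                           | χ-true (i Fin.≟ j) (Fin.toℕ-injective b) = refl
  ... | tri> ¬a ¬b c rewrite χ-false (toℕ i <? toℕ j) ¬a | χ-true (toℕ j <? toℕ i) c
                           | χ-false (i Fin.≟ j) (¬b ∘ cong toℕ) = refl

-- The Kendall tau distance of the two orders that injective `x` and `y` define. Each discordant
-- pair is counted once, in the order in which `x` ascends.
inversions : (x y : Fin n → ℕ) → ℕ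
inversions {n} x y = ∑[ a < n ] ∑[ b < n ] (χ (x a <? x b) * χ (y b <? y a))

inversions-congˡ : {x x′ y : Fin n → ℕ} → x ≗ x′ → inversions x y ≡ inversions x′ y
inversions-congˡ {y = y} e = sum-cong-≗ (λ a → sum-cong-≗ (λ b →
  cong₂ (λ p q → χ (p <? q) * χ (y b <? y a)) (e a) (e b)))

inversions-refl : (x : Fin n → ℕ) → inversions x x ≡ 0
inversions-refl x = ∑-zero (λ a → ∑-zero (λ b → term a b))
  where
  term : ∀ a b → χ (x a <? x b) * χ (x b <? x a) ≡ 0
  term a b with x a <? x b
  ... | yes p = trans (+-identityʳ _) (χ-false (x b <? x a) (<-asym p))
  ... | no _  = refl

inversions≤ : (x y : Fin n → ℕ) → inversions x y ≤ ∑[ a < n ] ∑[ b < n ] χ (x a <? x b)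
inversions≤ x y = ∑-mono-≤ (λ a → ∑-mono-≤ (λ b →
  ≤-trans (*-monoʳ-≤ (χ (x a <? x b)) (χ≤1 (y b <? y a))) (≤-reflexive (*-identityʳ _))))

inversions-reversed : (x y : Fin n → ℕ) → (∀ a b → x a < x b → y b < y a) →
  inversions x y ≡ ∑[ a < n ] ∑[ b < n ] χ (x a <? x b)
inversions-reversed x y anti = sum-cong-≗ (λ a → sum-cong-≗ (λ b → term a b))
  where
  term : ∀ a b → χ (x a <? x b) * χ (y b <? y a) ≡ χ (x a <? x b)
  term a b with x a <? x b
  ... | yes p = trans (+-identityʳ _) (χ-true (y b <? y a) (anti a b p))
  ... | no _  = refl

∑∑-permute : (f : Fin n → Fin n → ℕ) (ρ : Permutation′ n) →
  ∑[ i < n ] ∑[ j < n ] f i j ≡ ∑[ i < n ] ∑[ j < n ] f (ρ ⟨$⟩ʳ i) (ρ ⟨$⟩ʳ j)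
∑∑-permute f ρ = trans (∑-permute _ ρ) (sum-cong-≗ (λ i → ∑-permute (f (ρ ⟨$⟩ʳ i)) ρ))

-- The graph of the transposition (p, p + 1) of ℕ.
data Swapped (p : ℕ) : ℕ → ℕ → Set where
  up    : Swapped p p (suc p)
  down  : Swapped p (suc p) p
  fixed : ∀ {k} → k ≢ p → k ≢ suc p → Swapped p k k

-- Only the comparison of p with p + 1 is affected by the swap: the pair (p, p + 1) stops ascending
-- and the pair (p + 1, p) starts to. The two products are the indicators of these pairs, each
-- placed on the side that needs it.
swapped-< : ∀ {p s s′ t t′} → Swapped p s t → Swapped p s′ t′ →
  χ (t <? t′) ⊕ χ (s ≟ p) * χ (s′ ≟ suc p) ≡ χ (s <? s′) ⊕ χ (s ≟ suc p) * χ (s′ ≟ p)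
swapped-< {p} up up
  rewrite χ-false (suc p <? suc p) (<-irrefl refl) | χ-false (p <? p) (<-irrefl refl)
        | χ-true (p ≟ p) refl | χ-false (p ≟ suc p) (1+n≢n ∘ sym) = refl
swapped-< {p} up down
  rewrite χ-false (suc p <? p) (<-asym (n<1+n p)) | χ-true (p <? suc p) (n<1+n p)
        | χ-true (p ≟ p) refl | χ-false (p ≟ suc p) (1+n≢n ∘ sym) | χ-true (suc p ≟ suc p) refl = refl
swapped-< {p} {s′ = s′} up (fixed ≢p ≢1+p)
  rewrite χ-cong (suc p <? s′) (p <? s′) <⇒≤ (λ p< → ≤∧≢⇒< p< (≢1+p ∘ sym))
        | χ-false (s′ ≟ suc p) ≢1+p | χ-false (s′ ≟ p) ≢p
        | *-zeroʳ (χ (p ≟ p)) | *-zeroʳ (χ (p ≟ suc p)) = refl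
swapped-< {p} down up
  rewrite χ-false (suc p <? p) (<-asym (n<1+n p)) | χ-true (p <? suc p) (n<1+n p)
        | χ-true (p ≟ p) refl | χ-false (suc p ≟ p) 1+n≢n | χ-true (suc p ≟ suc p) refl = refl
swapped-< {p} down down
  rewrite χ-false (suc p <? suc p) (<-irrefl refl) | χ-false (p <? p) (<-irrefl refl)
        | χ-true (suc p ≟ suc p) refl | χ-false (suc p ≟ p) 1+n≢n = refl
swapped-< {p} {s′ = s′} down (fixed ≢p ≢1+p)
  rewrite χ-cong (p <? s′) (suc p <? s′) (λ p< → ≤∧≢⇒< p< (≢1+p ∘ sym)) <⇒≤
        | χ-false (s′ ≟ suc p) ≢1+p | χ-false (s′ ≟ p) ≢p
        | *-zeroʳ (χ (suc p ≟ p)) | *-zeroʳ (χ (suc p ≟ suc p)) = refl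
swapped-< {p} {s} (fixed ≢p ≢1+p) up
  rewrite χ-cong (s <? suc p) (s <? p) (λ s< → ≤∧≢⇒< (s≤s⁻¹ s<) ≢p) m<n⇒m<1+n
        | χ-false (s ≟ suc p) ≢1+p | χ-false (s ≟ p) ≢p = refl
swapped-< {p} {s} (fixed ≢p ≢1+p) down
  rewrite χ-cong (s <? p) (s <? suc p) m<n⇒m<1+n (λ s< → ≤∧≢⇒< (s≤s⁻¹ s<) ≢p)
        | χ-false (s ≟ suc p) ≢1+p | χ-false (s ≟ p) ≢p = refl
swapped-< {p} {s} (fixed ≢p ≢1+p) (fixed _ _)
  rewrite χ-false (s ≟ suc p) ≢1+p | χ-false (s ≟ p) ≢p = refl

∑∑-select : (x : Fin n → ℕ) → Injective _≡_ _≡_ x → (g : Fin n → Fin n → ℕ) (a₀ b₀ : Fin n) {p q : ℕ} →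
  x a₀ ≡ p → x b₀ ≡ q →
  ∑[ a < n ] ∑[ b < n ] (χ (x a ≟ p) * χ (x b ≟ q) * g a b) ≡ g a₀ b₀
∑∑-select {n} x inj g a₀ b₀ {p} {q} refl refl = begin
  ∑[ a < n ] ∑[ b < n ] (χ (x a ≟ p) * χ (x b ≟ q) * g a b)
    ≡⟨ sum-cong-≗ {n} (λ a → trans (sum-cong-≗ {n} (λ b → *-assoc (χ (x a ≟ p)) (χ (x b ≟ q)) (g a b))) (∑-*ˡ (χ (x a ≟ p)) (λ b → χ (x b ≟ q) * g a b))) ⟩
  ∑[ a < n ] (χ (x a ≟ p) * ∑[ b < n ] (χ (x b ≟ q) * g a b))
    ≡⟨ ∑-select (λ a → x a ≟ p) (λ a → ∑[ b < n ] (χ (x b ≟ q) * g a b)) refl (λ _ → inj) ⟩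
  ∑[ b < n ] (χ (x b ≟ q) * g a₀ b)
    ≡⟨ ∑-select (λ b → x b ≟ q) (g a₀) refl (λ _ → inj) ⟩
  g a₀ b₀ ∎
  where open ≡-Reasoning

-- A swap of the values p and p + 1 changes the number of inversions by ±1;
-- both sides are arranged so that no subtraction occurs.
inversions-swap : ∀ {x x′ : Fin n → ℕ} (y : Fin n → ℕ) {p} a₀ b₀ → Injective _≡_ _≡_ x →
  (∀ a → Swapped p (x a) (x′ a)) → x a₀ ≡ p → x b₀ ≡ suc p →
  inversions x′ y ⊕ χ (y b₀ <? y a₀) ≡ inversions x y ⊕ χ (y a₀ <? y b₀)
inversions-swap {n} {x} {x′} y {p} a₀ b₀ inj swapped xa xb = begin
  inversions x′ y ⊕ B a₀ b₀
    ≡⟨ cong (inversions x′ y ⊕_) (sym (∑∑-select x inj B a₀ b₀ xa xb)) ⟩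
  inversions x′ y ⊕ ∑[ a < n ] ∑[ b < n ] (χ (x a ≟ p) * χ (x b ≟ suc p) * B a b)
    ≡⟨ sym (∑∑-distrib-+ {n} _ _) ⟩
  ∑[ a < n ] ∑[ b < n ] (χ (x′ a <? x′ b) * B a b ⊕ χ (x a ≟ p) * χ (x b ≟ suc p) * B a b)
    ≡⟨ sum-cong-≗ (λ a → sum-cong-≗ (λ b →
         trans (sym (*-distribʳ-+ (B a b) (χ (x′ a <? x′ b)) _))
        (trans (cong (_* B a b) (swapped-< (swapped a) (swapped b)))
               (*-distribʳ-+ (B a b) (χ (x a <? x b)) _)))) ⟩
  ∑[ a < n ] ∑[ b < n ] (χ (x a <? x b) * B a b ⊕ χ (x a ≟ suc p) * χ (x b ≟ p) * B a b)
    ≡⟨ ∑∑-distrib-+ {n} _ _ ⟩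
  inversions x y ⊕ ∑[ a < n ] ∑[ b < n ] (χ (x a ≟ suc p) * χ (x b ≟ p) * B a b)
    ≡⟨ cong (inversions x y ⊕_) (∑∑-select x inj B b₀ a₀ xb xa) ⟩
  inversions x y ⊕ B b₀ a₀ ∎
  where
  open ≡-Reasoning
  B : Fin n → Fin n → ℕ
  B a b = χ (y b <? y a)

-- Increasing maps, steps on the number line and transpositions

-- Climbing from the bottom gives f(i) ≥ i. Descending from the top, where the value is at most n -
-- 1, gives f(i) ≤ i.
increasing⇒toℕ : (f : Fin n → ℕ) → (∀ i → f i < n) →
  (∀ i j → toℕ j ≡ suc (toℕ i) → f i < f j) → f ≗ toℕ
increasing⇒toℕ {suc n} f f<n ascent i = ≤-antisym (below i) (above i)
  where
  ascent′ : ∀ i → f (inject₁ i) < f (suc i)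
  ascent′ i = ascent (inject₁ i) (suc i) (cong suc (sym (Fin.toℕ-inject₁ i)))

  above : ∀ i → toℕ i ≤ f i
  above = <-weakInduction (λ i → toℕ i ≤ f i) z≤n
    (λ i ih → ≤-<-trans (subst (_≤ f (inject₁ i)) (Fin.toℕ-inject₁ i) ih) (ascent′ i))

  below : ∀ i → f i ≤ toℕ i
  below = >-weakInduction (λ i → f i ≤ toℕ i)
    (subst (f (fromℕ n) ≤_) (sym (Fin.toℕ-fromℕ n)) (s≤s⁻¹ (f<n (fromℕ n))))
    (λ i ih → subst (f (inject₁ i) ≤_) (sym (Fin.toℕ-inject₁ i))
      (s≤s⁻¹ (<-≤-trans (ascent′ i) ih)))

-- A single step from `p` towards `q`. The last component keeps `r` within any upper bound common to
-- `p` and `q`, so that `r` is again a position on the path.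
approach : ∀ p q {k} → ∣ p - q ∣ ≡ suc k →
  ∃[ r ] (r ≡ suc p ⊎ p ≡ suc r) × ∣ r - q ∣ ≡ k × (r ≤ p ⊎ r ≤ q)
approach zero    (suc q) e = 1 , inj₁ refl , suc-injective e , inj₂ (s≤s z≤n)
approach (suc p) zero    e = p , inj₂ refl , trans (∣-∣-identityʳ p) (suc-injective e) , inj₁ (n≤1+n p)
approach (suc p) (suc q) e with approach p q e
... | r , s , d , b = suc r , Sum.map (cong suc) (cong suc) s , d , Sum.map s≤s s≤s b

∣n-1+n∣≡1 : ∀ n → ∣ n - suc n ∣ ≡ 1
∣n-1+n∣≡1 zero    = refl
∣n-1+n∣≡1 (suc n) = ∣n-1+n∣≡1 n

transpose-comm : (i j k : Fin n) → PC.transpose i j k ≡ PC.transpose j i k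
transpose-comm i j k with k Fin.≟ i
... | yes refl with k Fin.≟ j
...   | yes refl = refl
...   | no _ rewrite dec-true (k Fin.≟ k) refl = refl
transpose-comm i j k | no k≢i with k Fin.≟ j
...   | yes refl = refl
...   | no _ rewrite dec-false (k Fin.≟ i) k≢i = refl

transpose-swapped : (σ : Permutation′ n) (i j : Fin n) → toℕ (σ ⟨$⟩ʳ j) ≡ suc (toℕ (σ ⟨$⟩ʳ i)) →
  ∀ k → Swapped (toℕ (σ ⟨$⟩ʳ i)) (toℕ (σ ⟨$⟩ʳ PC.transpose i j k)) (toℕ (σ ⟨$⟩ʳ k))
transpose-swapped σ i j e k with k Fin.≟ i
... | yes refl rewrite e = down
... | no k≢i with k Fin.≟ j
...   | yes refl rewrite e = up
...   | no k≢j = fixed (k≢i ∘ injective σ ∘ Fin.toℕ-injective)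
                       (λ e′ → k≢j (injective σ (Fin.toℕ-injective (trans e′ (sym e)))))

-- Counting cycles

sameCycle-trans : (π : Permutation′ n) → Transitive (SameCycle π)
sameCycle-trans π {i} (k , e) (l , f) =
  l ⊕ k , trans (fold-+ i (π ⟨$⟩ʳ_) l {k}) (trans (cong (λ x → fold x (π ⟨$⟩ʳ_) l) e) f)

-- If p + 1 steps lead from i back to i, then p steps lead there from π(i).
sameCycle-preimage : (π : Permutation′ n) (i : Fin n) → SameCycle π (π ⟨$⟩ʳ i) i
sameCycle-preimage π i with period π i
... | suc p , _ , _ , e = p , trans (rotate p) e
  where
  rotate : ∀ k → fold (π ⟨$⟩ʳ i) (π ⟨$⟩ʳ_) k ≡ π ⟨$⟩ʳ fold i (π ⟨$⟩ʳ_) k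
  rotate zero    = refl
  rotate (suc k) = cong (π ⟨$⟩ʳ_) (rotate k)

-- The head filters a tail that is already deduplicated, and filtering preserves pairwise
-- properties. The relation is excluded only from earlier to later elements.
deduplicate-allPairs : {A : Set} {R : A → A → Set} (R? : Decidable R) (xs : List A) →
  AllPairs (λ x y → ¬ R x y) (deduplicate R? xs)
deduplicate-allPairs R? []       = []
deduplicate-allPairs R? (x ∷ xs) =
  all-filter (¬? ∘ R? x) (deduplicate R? xs) ∷ filter⁺ (¬? ∘ R? x) (deduplicate-allPairs R? xs)

infix 4 _∈?_

_∈?_ : (i : Fin n) (xs : List (Fin n)) → Dec (i ∈ xs)
i ∈? xs = any? (i Fin.≟_) xs

∑-∈-unique : {xs : List (Fin n)} → AllPairs _≢_ xs → ∑[ i < n ] χ (i ∈? xs) ≡ length xs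
∑-∈-unique {n} {[]}     []         = ∑-zero {n} (λ i → χ-false (i ∈? []) λ ())
∑-∈-unique {n} {x ∷ xs} (x∉ ∷ uniq) = begin
  ∑[ i < n ] χ (i ∈? (x ∷ xs))
    ≡⟨ sum-cong-≗ cons ⟩
  ∑[ i < n ] (χ (i Fin.≟ x) ⊕ χ (i ∈? xs))
    ≡⟨ ∑-distrib-+ (λ i → χ (i Fin.≟ x)) (λ i → χ (i ∈? xs)) ⟩
  ∑[ i < n ] χ (i Fin.≟ x) ⊕ ∑[ i < n ] χ (i ∈? xs)
    ≡⟨ cong₂ _⊕_ (∑-count (Fin._≟ x) refl (λ _ e → e)) (∑-∈-unique uniq) ⟩
  suc (length xs) ∎
  where
  open ≡-Reasoning
  cons : ∀ i → χ (i ∈? (x ∷ xs)) ≡ χ (i Fin.≟ x) ⊕ χ (i ∈? xs)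
  cons i with i Fin.≟ x
  ... | yes refl = cong suc (sym (χ-false (i ∈? xs) (λ i∈ → All-lookup x∉ i∈ refl)))
  ... | no i≢x   = χ-cong _ (i ∈? xs) (λ { (here e) → ⊥-elim (i≢x e) ; (there i∈) → i∈ }) there

fixedPoints : Permutation′ n → ℕ
fixedPoints {n} π = ∑[ i < n ] χ (π ⟨$⟩ʳ i Fin.≟ i)

module _ (π : Permutation′ n) where
  private
    representatives : List (Fin n)
    representatives = deduplicate (sameCycle? π) (allFin n)

    pairwise : AllPairs (λ i j → ¬ SameCycle π i j) representatives
    pairwise = deduplicate-allPairs (sameCycle? π) (allFin n)

    ρ : Fin n → ℕ
    ρ i = χ (i ∈? representatives)

    -- Every representative is met twice, once as i and once as π(i), because π permutes the
    -- indices.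
    ∑ρ : ∑[ i < n ] (ρ i ⊕ ρ (π ⟨$⟩ʳ i)) ≡ 2 * cycleCount π
    ∑ρ = trans (∑-distrib-+ ρ (ρ ∘ (π ⟨$⟩ʳ_)))
      (cong₂ _⊕_ count (trans (sym (∑-permute ρ π)) (trans count (sym (+-identityʳ _)))))
      where
      count : ∑[ i < n ] ρ i ≡ cycleCount π
      count = ∑-∈-unique (AllPairs.map (λ { ¬same refl → ¬same (0 , refl) }) pairwise)

    ∑1+fixed : ∑[ i < n ] (1 ⊕ χ (π ⟨$⟩ʳ i Fin.≟ i)) ≡ n ⊕ fixedPoints π
    ∑1+fixed = trans (∑-distrib-+ {n} (λ _ → 1) (λ i → χ (π ⟨$⟩ʳ i Fin.≟ i)))
      (cong (_⊕ fixedPoints π) (trans (∑-const n 1) (*-identityʳ n)))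

    sharing : ∀ i → ρ i ⊕ ρ (π ⟨$⟩ʳ i) ≤ 1 ⊕ χ (π ⟨$⟩ʳ i Fin.≟ i)
    sharing i with π ⟨$⟩ʳ i Fin.≟ i
    ... | yes _  = +-mono-≤ (χ≤1 (i ∈? representatives)) (χ≤1 (π ⟨$⟩ʳ i ∈? representatives))
    ... | no πi≢i with i ∈? representatives | π ⟨$⟩ʳ i ∈? representatives
    ...   | no _   | d      = χ≤1 d
    ...   | yes _  | no _   = ≤-refl
    -- It is unknown which of i and π(i) comes first in the list, so both directions of `SameCycle`
    -- have to be refuted.
    ...   | yes i∈ | yes πi∈ = ⊥-elim (case ∈-AllPairs₂ pairwise i∈ πi∈ of λ
      { (inj₁ e)        → πi≢i (sym e)
      ; (inj₂ (inj₁ f)) → f (1 , refl)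
      ; (inj₂ (inj₂ f)) → f (sameCycle-preimage π i) })

    -- An element is dropped only in favour of one whose cycle reaches it; by transitivity some
    -- element reaching i survives.
    represented : ∀ i → ∃[ r ] r ∈ representatives × SameCycle π r i
    represented i = find (Any.deduplicate⁺ (sameCycle? π) (sameCycle-trans π)
      (Any.map (λ { refl → 0 , refl }) (∈-allFin i)))

  2*cycleCount≤n+fixedPoints : 2 * cycleCount π ≤ n ⊕ fixedPoints π
  2*cycleCount≤n+fixedPoints = subst₂ _≤_ ∑ρ ∑1+fixed (∑-mono-≤ sharing)

  -- The cycle of i is just {i, π(i)}, so at least one of the two is a representative. At a fixed
  -- point both terms count the same representative, which pays for the extra one.
  involution⇒n+fixedPoints≤2*cycleCount : (∀ i → π ⟨$⟩ʳ (π ⟨$⟩ʳ i) ≡ i) →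
    n ⊕ fixedPoints π ≤ 2 * cycleCount π
  involution⇒n+fixedPoints≤2*cycleCount inv = subst₂ _≤_ ∑1+fixed ∑ρ (∑-mono-≤ covering)
    where
    orbit : ∀ r k → fold r (π ⟨$⟩ʳ_) k ≡ r ⊎ fold r (π ⟨$⟩ʳ_) k ≡ π ⟨$⟩ʳ r
    orbit r zero    = inj₁ refl
    orbit r (suc k) with orbit r k
    ... | inj₁ e = inj₂ (cong (π ⟨$⟩ʳ_) e)
    ... | inj₂ e = inj₁ (trans (cong (π ⟨$⟩ʳ_) e) (inv r))

    one-of : ∀ i → i ∈ representatives ⊎ π ⟨$⟩ʳ i ∈ representatives
    one-of i with represented i
    ... | r , r∈ , k , refl with orbit r k
    ...   | inj₁ e = inj₁ (subst (_∈ representatives) (sym e) r∈)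
    ...   | inj₂ e = inj₂ (subst (_∈ representatives) (sym (trans (cong (π ⟨$⟩ʳ_) e) (inv r))) r∈)

    covering : ∀ i → 1 ⊕ χ (π ⟨$⟩ʳ i Fin.≟ i) ≤ ρ i ⊕ ρ (π ⟨$⟩ʳ i)
    covering i with π ⟨$⟩ʳ i Fin.≟ i | one-of i
    ... | yes e | inj₁ i∈  rewrite e | χ-true (i ∈? representatives) i∈ = ≤-refl
    ... | yes e | inj₂ πi∈ rewrite e | χ-true (i ∈? representatives) πi∈ = ≤-refl
    ... | no _  | inj₁ i∈  rewrite χ-true (i ∈? representatives) i∈ = s≤s z≤n
    ... | no _  | inj₂ πi∈ rewrite χ-true (π ⟨$⟩ʳ i ∈? representatives) πi∈ = m≤n+m 1 (ρ i)

-- Displacement along the path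

-- Twice the distance of i from the centre of the path; the factor keeps it integral when the centre
-- lies between two positions.
width : Fin n → ℕ
width i = ∣ toℕ i - toℕ (opposite i) ∣

i+opposite : (i : Fin n) → suc (toℕ i ⊕ toℕ (opposite i)) ≡ n
i+opposite i = trans (cong (suc (toℕ i) ⊕_) (Fin.opposite-prop i)) (m+[n∸m]≡n (Fin.toℕ<n i))

-- The indicator adds one for the middle position when n is odd, so that both parities share one
-- closed form.
∑-width : ∀ n → ∑[ i < n ] (2 * width i ⊕ χ (opposite i Fin.≟ i)) ≡ n * n
∑-width n = trans (sum-cong-≗ {n} (λ i → cong₂ (λ a b → 2 * a ⊕ b)
    (cong (λ q → ∣ toℕ i - q ∣) (Fin.opposite-prop i))
    (χ-cong (opposite i Fin.≟ i) (n ∸ suc (toℕ i) ≟ toℕ i)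
      (λ e → trans (sym (Fin.opposite-prop i)) (cong toℕ e))
      (λ e → Fin.toℕ-injective (trans (Fin.opposite-prop i) e)))))
  (∑-H n)
  where
  -- The summand on natural numbers, so that the length and the position can vary independently in
  -- the induction.
  H : ℕ → ℕ → ℕ
  H n p = 2 * ∣ p - (n ∸ suc p) ∣ ⊕ χ (n ∸ suc p ≟ p)

  H-suc : ∀ n p → p < n → H (2 ⊕ n) (suc p) ≡ H n p
  H-suc n p p<n rewrite +-∸-assoc 1 p<n = cong (2 * ∣ p - (n ∸ suc p) ∣ ⊕_)
    (χ-cong (suc (n ∸ suc p) ≟ suc p) (n ∸ suc p ≟ p) suc-injective (cong suc))

  H-first : ∀ n → H (2 ⊕ n) 0 ≡ 2 * suc n
  H-first n = trans (cong (2 * suc n ⊕_) (χ-false (suc n ≟ 0) λ ())) (+-identityʳ _)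

  H-last : ∀ n → H (2 ⊕ n) (suc n) ≡ 2 * suc n
  H-last n rewrite n∸n≡0 n = trans (cong (2 * suc n ⊕_) (χ-false (0 ≟ suc n) λ ())) (+-identityʳ _)

  -- Removing the two ends of the path shortens it by two and keeps its centre.
  ∑-H : ∀ n → ∑[ i < n ] H n (toℕ i) ≡ n * n
  ∑-H 0 = refl
  ∑-H 1 = refl
  ∑-H (suc (suc n)) = begin
    H (2 ⊕ n) 0 ⊕ ∑[ i < suc n ] H (2 ⊕ n) (suc (toℕ i))
      ≡⟨ cong (H (2 ⊕ n) 0 ⊕_) (sum-init-last {n} (λ i → H (2 ⊕ n) (suc (toℕ i)))) ⟩
    H (2 ⊕ n) 0 ⊕ (∑[ i < n ] H (2 ⊕ n) (suc (toℕ (inject₁ i))) ⊕ H (2 ⊕ n) (suc (toℕ (fromℕ n))))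
      ≡⟨ cong₂ _⊕_ (H-first n) (cong₂ _⊕_
           (sum-cong-≗ (λ i → trans (cong (H (2 ⊕ n) ∘ suc) (Fin.toℕ-inject₁ i)) (H-suc n (toℕ i) (Fin.toℕ<n i))))
           (trans (cong (H (2 ⊕ n) ∘ suc) (Fin.toℕ-fromℕ n)) (H-last n))) ⟩
    2 * suc n ⊕ (∑[ i < n ] H n (toℕ i) ⊕ 2 * suc n)
      ≡⟨ cong (λ s → 2 * suc n ⊕ (s ⊕ 2 * suc n)) (∑-H n) ⟩
    2 * suc n ⊕ (n * n ⊕ 2 * suc n)
      ≡⟨ square n ⟩
    suc (suc n) * suc (suc n) ∎
    where
    open ≡-Reasoning
    square : ∀ n → 2 * suc n ⊕ (n * n ⊕ 2 * suc n) ≡ suc (suc n) * suc (suc n)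
    square = solve-∀

-- The triangle inequality through the centre, doubled: `p′` and `q′` play the mirror images of `p`
-- and `q`. The gaps q - p and p′ - q′ agree, so adding both to p + q′ yields q + p′.
2*∣-∣≤ : ∀ {p p′ q q′} → p ⊕ p′ ≡ q ⊕ q′ → p ≤ q → 2 * ∣ p - q ∣ ≤ ∣ p - p′ ∣ ⊕ ∣ q - q′ ∣
2*∣-∣≤ {p} {p′} {q} {q′} e p≤q = +-cancelˡ-≤ (p ⊕ q′) _ _ (begin
  p ⊕ q′ ⊕ 2 * ∣ p - q ∣                     ≡⟨ split p q′ ∣ p - q ∣ ⟩
  (p ⊕ ∣ p - q ∣) ⊕ (q′ ⊕ ∣ p - q ∣)         ≡⟨ cong₂ _⊕_ q≡ p′≡ ⟩
  q ⊕ p′                                     ≤⟨ +-mono-≤ (m≤n+∣m-n∣ q q′) (m≤n+∣n-m∣ p′ p) ⟩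
  (q′ ⊕ ∣ q - q′ ∣) ⊕ (p ⊕ ∣ p - p′ ∣)       ≡⟨ regroup q′ ∣ q - q′ ∣ p ∣ p - p′ ∣ ⟩
  p ⊕ q′ ⊕ (∣ p - p′ ∣ ⊕ ∣ q - q′ ∣)         ∎)
  where
  open ≤-Reasoning
  split : ∀ a b c → a ⊕ b ⊕ 2 * c ≡ (a ⊕ c) ⊕ (b ⊕ c)
  split = solve-∀

  regroup : ∀ a b c d → (a ⊕ b) ⊕ (c ⊕ d) ≡ c ⊕ a ⊕ (d ⊕ b)
  regroup = solve-∀

  swap : ∀ a b c → a ⊕ b ⊕ c ≡ a ⊕ (c ⊕ b)
  swap = solve-∀

  q≡ : p ⊕ ∣ p - q ∣ ≡ q
  q≡ = trans (cong (p ⊕_) (m≤n⇒∣m-n∣≡n∸m p≤q)) (m+[n∸m]≡n p≤q)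

  p′≡ : q′ ⊕ ∣ p - q ∣ ≡ p′
  p′≡ = +-cancelˡ-≡ p _ _ (trans (sym (swap p ∣ p - q ∣ q′)) (trans (cong (_⊕ q′) q≡) (sym e)))

2*∣-∣≤width : (p q : Fin n) → 2 * ∣ toℕ p - toℕ q ∣ ≤ width p ⊕ width q
2*∣-∣≤width p q with ≤-total (toℕ p) (toℕ q)
... | inj₁ p≤q = 2*∣-∣≤ (suc-injective (trans (i+opposite p) (sym (i+opposite q)))) p≤q
... | inj₂ q≤p = subst₂ _≤_ (cong (2 *_) (∣-∣-comm (toℕ q) (toℕ p))) (+-comm (width q) (width p))
                   (2*∣-∣≤ (suc-injective (trans (i+opposite q) (sym (i+opposite p)))) q≤p)

1≤2*width : (p : Fin n) → 1 ≤ 2 * width p ⊕ χ (opposite p Fin.≟ p)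
1≤2*width p with opposite p Fin.≟ p
... | yes _ = m≤n+m 1 _
... | no ≢  = ≤-trans (≤-trans (n≢0⇒n>0 (≢ ∘ sym ∘ Fin.toℕ-injective ∘ ∣m-n∣≡0⇒m≡n)) (m≤m+n _ _)) (m≤m+n _ _)

-- From here on σ i is the position of the vertex i along the path.
module _ (σ : Permutation′ n) where

  pathDist : Fin n → Fin n → ℕ
  pathDist i j = ∣ toℕ (σ ⟨$⟩ʳ i) - toℕ (σ ⟨$⟩ʳ j) ∣

  displacement : Permutation′ n → ℕ
  displacement π = ∑[ i < n ] pathDist i (π ⟨$⟩ʳ i)

  private
    ∑-split : (f : Fin n → ℕ) (π : Permutation′ n) →
      ∑[ i < n ] (2 * f i ⊕ χ (π ⟨$⟩ʳ i Fin.≟ i)) ≡ 2 * ∑[ i < n ] f i ⊕ fixedPoints π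
    ∑-split f π = trans (∑-distrib-+ {n} (λ i → 2 * f i) _) (cong (_⊕ fixedPoints π) (∑-*ˡ 2 f))

    ∑-width-σ : ∑[ i < n ] (2 * width (σ ⟨$⟩ʳ i) ⊕ χ (opposite (σ ⟨$⟩ʳ i) Fin.≟ σ ⟨$⟩ʳ i)) ≡ n * n
    ∑-width-σ = trans (sym (∑-permute _ σ)) (∑-width n)

  -- A nonfixed i pays for its displacement with the distances of both ends
  -- from the centre; a fixed point wastes its own, unless it is the centre.
  2*displacement+fixedPoints≤n² : (π : Permutation′ n) → 2 * displacement π ⊕ fixedPoints π ≤ n * n
  2*displacement+fixedPoints≤n² π = begin
    2 * displacement π ⊕ fixedPoints π
      ≡⟨ sym (∑-split _ π) ⟩
    ∑[ i < n ] (2 * pathDist i (π ⟨$⟩ʳ i) ⊕ χ (π ⟨$⟩ʳ i Fin.≟ i))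
      ≤⟨ ∑-mono-≤ term ⟩
    ∑[ i < n ] (w i ⊕ w (π ⟨$⟩ʳ i) ⊕ c i)
      ≡⟨ ∑-distrib-+ (λ i → w i ⊕ w (π ⟨$⟩ʳ i)) c ⟩
    ∑[ i < n ] (w i ⊕ w (π ⟨$⟩ʳ i)) ⊕ ∑[ i < n ] c i
      ≡⟨ cong (_⊕ ∑[ i < n ] c i) (∑-distrib-+ w (w ∘ (π ⟨$⟩ʳ_))) ⟩
    ∑[ i < n ] w i ⊕ ∑[ i < n ] w (π ⟨$⟩ʳ i) ⊕ ∑[ i < n ] c i
      ≡⟨ cong (λ s → ∑[ i < n ] w i ⊕ s ⊕ ∑[ i < n ] c i) (trans (sym (∑-permute w π)) (sym (+-identityʳ _))) ⟩
    2 * ∑[ i < n ] w i ⊕ ∑[ i < n ] c i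
      ≡⟨ cong (_⊕ ∑[ i < n ] c i) (sym (∑-*ˡ 2 w)) ⟩
    ∑[ i < n ] (2 * w i) ⊕ ∑[ i < n ] c i
      ≡⟨ sym (∑-distrib-+ (λ i → 2 * w i) c) ⟩
    ∑[ i < n ] (2 * w i ⊕ c i)
      ≡⟨ ∑-width-σ ⟩
    n * n ∎
    where
    open ≤-Reasoning
    w c : Fin n → ℕ
    w i = width (σ ⟨$⟩ʳ i)
    c i = χ (opposite (σ ⟨$⟩ʳ i) Fin.≟ σ ⟨$⟩ʳ i)

    term : ∀ i → 2 * pathDist i (π ⟨$⟩ʳ i) ⊕ χ (π ⟨$⟩ʳ i Fin.≟ i) ≤ w i ⊕ w (π ⟨$⟩ʳ i) ⊕ c i
    term i with π ⟨$⟩ʳ i Fin.≟ i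
    ... | yes e rewrite e | ∣n-n∣≡0 (toℕ (σ ⟨$⟩ʳ i)) =
      subst (λ s → 1 ≤ w i ⊕ s ⊕ c i) (+-identityʳ _) (1≤2*width (σ ⟨$⟩ʳ i))
    ... | no _ = ≤-trans (≤-reflexive (+-identityʳ _))
      (≤-trans (2*∣-∣≤width (σ ⟨$⟩ʳ i) (σ ⟨$⟩ʳ (π ⟨$⟩ʳ i))) (m≤m+n _ _))

  -- The mirror symmetry of the path, carried from positions to vertices by conjugation with `σ`.
  reversal : Permutation′ n
  reversal = σ ∘ₚ reverse ∘ₚ flip σ

  σ-reversal : ∀ i → σ ⟨$⟩ʳ (reversal ⟨$⟩ʳ i) ≡ opposite (σ ⟨$⟩ʳ i)
  σ-reversal i = inverseʳ σ

  reversal-involutive : ∀ i → reversal ⟨$⟩ʳ (reversal ⟨$⟩ʳ i) ≡ i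
  reversal-involutive i = trans
    (cong (λ p → σ ⟨$⟩ˡ opposite p) (σ-reversal i))
    (trans (cong (σ ⟨$⟩ˡ_) (Fin.opposite-involutive _)) (inverseˡ σ))

  -- A vertex and its image lie symmetrically about the centre, so their distance is the `width` and
  -- the sums agree term by term.
  2*displacement+fixedPoints-reversal : 2 * displacement reversal ⊕ fixedPoints reversal ≡ n * n
  2*displacement+fixedPoints-reversal = trans (sym (∑-split _ reversal))
    (trans (sum-cong-≗ term) ∑-width-σ)
    where
    term : ∀ i → 2 * pathDist i (reversal ⟨$⟩ʳ i) ⊕ χ (reversal ⟨$⟩ʳ i Fin.≟ i) ≡
                 2 * width (σ ⟨$⟩ʳ i) ⊕ χ (opposite (σ ⟨$⟩ʳ i) Fin.≟ σ ⟨$⟩ʳ i)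
    term i = cong₂ (λ a b → 2 * a ⊕ b)
      (cong (λ p → ∣ toℕ (σ ⟨$⟩ʳ i) - toℕ p ∣) (σ-reversal i))
      (χ-cong (reversal ⟨$⟩ʳ i Fin.≟ i) (opposite (σ ⟨$⟩ʳ i) Fin.≟ σ ⟨$⟩ʳ i)
        (λ e → trans (sym (σ-reversal i)) (cong (σ ⟨$⟩ʳ_) e))
        (λ e → trans (cong (σ ⟨$⟩ˡ_) e) (inverseˡ σ)))

  -- Cycles and displacement combined

  private
    expand : ∀ a b c → 2 * (a ⊕ b) ⊕ c ≡ 2 * a ⊕ (2 * b ⊕ c)
    expand = solve-∀

    -- Expresses n² through `pairs n` and isolates `fixedPoints π` as the term to be cancelled.
    collect : (π : Permutation′ n) → n ⊕ fixedPoints π ⊕ n * n ≡ 2 * (n ⊕ pairs n) ⊕ fixedPoints π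
    collect π = trans (cong (n ⊕ fixedPoints π ⊕_) (sym (2*pairs+n≡n² n)))
      (regroup n (fixedPoints π) (pairs n))
      where
      regroup : ∀ a b c → a ⊕ b ⊕ (2 * c ⊕ a) ≡ 2 * (a ⊕ c) ⊕ b
      regroup = solve-∀

  cycleCount+displacement≤ : (π : Permutation′ n) → cycleCount π ⊕ displacement π ≤ n ⊕ pairs n
  cycleCount+displacement≤ π = *-cancelˡ-≤ 2 (+-cancelʳ-≤ (fixedPoints π) _ _ (begin
    2 * (cycleCount π ⊕ displacement π) ⊕ fixedPoints π   ≡⟨ expand (cycleCount π) (displacement π) _ ⟩
    2 * cycleCount π ⊕ (2 * displacement π ⊕ fixedPoints π)
      ≤⟨ +-mono-≤ (2*cycleCount≤n+fixedPoints π) (2*displacement+fixedPoints≤n² π) ⟩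
    n ⊕ fixedPoints π ⊕ n * n                              ≡⟨ collect π ⟩
    2 * (n ⊕ pairs n) ⊕ fixedPoints π                      ∎))
    where
    open ≤-Reasoning

  cycleCount+displacement-reversal : cycleCount reversal ⊕ displacement reversal ≡ n ⊕ pairs n
  cycleCount+displacement-reversal = ≤-antisym (cycleCount+displacement≤ reversal)
    (*-cancelˡ-≤ 2 (+-cancelʳ-≤ (fixedPoints reversal) _ _ (begin
      2 * (n ⊕ pairs n) ⊕ fixedPoints reversal
        ≡⟨ sym (collect reversal) ⟩
      n ⊕ fixedPoints reversal ⊕ n * n
        ≤⟨ +-mono-≤ (involution⇒n+fixedPoints≤2*cycleCount reversal reversal-involutive)
                    (≤-reflexive (sym 2*displacement+fixedPoints-reversal)) ⟩
      2 * cycleCount reversal ⊕ (2 * displacement reversal ⊕ fixedPoints reversal)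
        ≡⟨ sym (expand (cycleCount reversal) (displacement reversal) _) ⟩
      2 * (cycleCount reversal ⊕ displacement reversal) ⊕ fixedPoints reversal ∎)))
    where open ≤-Reasoning

  -- Distances in the Cayley graph

  -- A permutation `u` is read as placing the label u(i) at the vertex i. Right multiplication by an
  -- edge then exchanges the labels at two neighbouring vertices.
  position : Permutation′ n → Fin n → ℕ
  position u a = toℕ (σ ⟨$⟩ʳ (u ⟨$⟩ˡ a))

  position-injective : ∀ u → Injective _≡_ _≡_ (position u)
  position-injective u = injective (flip u) ∘ injective σ ∘ Fin.toℕ-injective

  position-image : ∀ u i → position u (u ⟨$⟩ʳ i) ≡ toℕ (σ ⟨$⟩ʳ i)
  position-image u i = cong (toℕ ∘ (σ ⟨$⟩ʳ_)) (inverseˡ u)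

  position-cong : ∀ {u v} → u Perm.≈ v → position u ≗ position v
  position-cong {u} {v} e a = trans (sym (position-image v (u ⟨$⟩ˡ a)))
    (cong (position v) (trans (sym (e _)) (inverseʳ u)))

  -- If `w` has the label `a` at the vertex k, then `u` has it at the image of k under the
  -- transposition, and `transpose-swapped` applies to k.
  position-swapped : ∀ {u w i j} → toℕ (σ ⟨$⟩ʳ j) ≡ suc (toℕ (σ ⟨$⟩ʳ i)) → w Perm.≈ u · transpose i j →
    ∀ a → Swapped (toℕ (σ ⟨$⟩ʳ i)) (position u a) (position w a)
  position-swapped {u} {w} {i} {j} e w≈ a =
    subst (λ s → Swapped (toℕ (σ ⟨$⟩ʳ i)) s (position w a)) (sym pos-u)
      (transpose-swapped σ i j e (w ⟨$⟩ˡ a))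
    where
    pos-u : position u a ≡ toℕ (σ ⟨$⟩ʳ PC.transpose i j (w ⟨$⟩ˡ a))
    pos-u = trans (cong (position u) (trans (sym (inverseʳ w)) (w≈ _))) (position-image u _)

  kendall : Permutation′ n → Permutation′ n → ℕ
  kendall u v = inversions (position u) (position v)

  kendall-cong : ∀ {u v} → u Perm.≈ v → kendall u v ≡ 0
  kendall-cong {u} {v} e = trans (inversions-congˡ (position-cong {u} {v} e)) (inversions-refl (position v))

  kendall-swap : ∀ {u w i j} v → toℕ (σ ⟨$⟩ʳ j) ≡ suc (toℕ (σ ⟨$⟩ʳ i)) → w Perm.≈ u · transpose i j →
    kendall w v ⊕ χ (position v (u ⟨$⟩ʳ j) <? position v (u ⟨$⟩ʳ i)) ≡
    kendall u v ⊕ χ (position v (u ⟨$⟩ʳ i) <? position v (u ⟨$⟩ʳ j))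
  kendall-swap {u} {w} {i} {j} v e w≈ = inversions-swap (position v) (u ⟨$⟩ʳ i) (u ⟨$⟩ʳ j)
    (position-injective u) (position-swapped {u} {w} e w≈) (position-image u i) (trans (position-image u j) e)

  kendall≤pairs : ∀ u v → kendall u v ≤ pairs n
  kendall≤pairs u v = ≤-trans (inversions≤ (position u) (position v))
    -- Labels are reindexed by their positions under `u`.
    (≤-reflexive (sym (∑∑-permute (λ i j → χ (toℕ i <? toℕ j)) (flip u ∘ₚ σ))))

  kendall-reversal : kendall Perm.id reversal ≡ pairs n
  kendall-reversal = trans
    (inversions-reversed (position Perm.id) (position reversal) (λ a b → subst₂ _<_ (sym (pos b)) (sym (pos a)) ∘ anti))
    (sym (∑∑-permute (λ i j → χ (toℕ i <? toℕ j)) σ))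
    where
    pos : ∀ a → position reversal a ≡ toℕ (opposite (σ ⟨$⟩ʳ a))
    pos a = cong toℕ (inverseʳ σ)

    anti : {i j : Fin n} → toℕ i < toℕ j → toℕ (opposite j) < toℕ (opposite i)
    anti {i} {j} i<j = subst₂ _<_ (sym (Fin.opposite-prop j)) (sym (Fin.opposite-prop i))
      (∸-monoʳ-< (s≤s i<j) (Fin.toℕ<n j))

  -- Walks in the path and in its Cayley graph

  module _ (T : Graph n)
    (iso : ∀ i j → SimpleGraph.Adj T i j ⇔ SimpleGraph.Adj (pathGraph n) (σ ⟨$⟩ʳ i) (σ ⟨$⟩ʳ j)) where

    private
      module T = SimpleGraph T

      to : ∀ {i j} → T.Adj i j → _
      to = Equivalence.to (iso _ _)

      from : ∀ {i j} → _ → T.Adj i j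
      from = Equivalence.from (iso _ _)

    pathDist-walk : ∀ k i j → pathDist i j ≡ k → Walk T k i j
    pathDist-walk zero    i j e = stop (injective σ (Fin.toℕ-injective (∣m-n∣≡0⇒m≡n e)))
    pathDist-walk (suc k) i j e with approach (toℕ (σ ⟨$⟩ʳ i)) (toℕ (σ ⟨$⟩ʳ j)) e
    ... | r , adj , d , b = step {v = i′}
      (from (Sum.map (trans σi′) (λ e′ → trans e′ (cong suc (sym σi′))) adj))
      (pathDist-walk k i′ j (trans (cong (λ p → ∣ p - toℕ (σ ⟨$⟩ʳ j) ∣) σi′) d))
      where
      r<n : r < n
      r<n = Sum.[ (λ r≤ → ≤-<-trans r≤ (Fin.toℕ<n _)) , (λ r≤ → ≤-<-trans r≤ (Fin.toℕ<n _)) ] b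

      i′ : Fin n
      i′ = σ ⟨$⟩ˡ fromℕ< r<n

      σi′ : toℕ (σ ⟨$⟩ʳ i′) ≡ r
      σi′ = trans (cong toℕ (inverseʳ σ)) (Fin.toℕ-fromℕ< r<n)

    pathDist-≤ : ∀ {k i j} → Walk T k i j → pathDist i j ≤ k
    pathDist-≤ {i = i} (stop refl) = ≤-reflexive (∣n-n∣≡0 (toℕ (σ ⟨$⟩ʳ i)))
    pathDist-≤ {i = i} {j} (step {v = i′} adj walk) =
      ≤-trans (∣-∣-triangle (toℕ (σ ⟨$⟩ʳ i)) (toℕ (σ ⟨$⟩ʳ i′)) (toℕ (σ ⟨$⟩ʳ j)))
        (+-mono-≤ (≤-reflexive (unit (to adj))) (pathDist-≤ walk))
      where
      unit : ∀ {p q} → q ≡ suc p ⊎ p ≡ suc q → ∣ p - q ∣ ≡ 1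
      unit {p} (inj₁ refl)     = ∣n-1+n∣≡1 p
      unit {q = q} (inj₂ refl) = trans (∣-∣-comm (suc q) q) (∣n-1+n∣≡1 q)

    pathDist-isDist : ∀ i j → IsDist T i j (pathDist i j)
    pathDist-isDist i j = pathDist-walk _ i j refl , λ _ → pathDist-≤

    kendall-step : ∀ {u w} v → SimpleGraph.Adj (cayleyGraph T) u w → kendall u v ≤ suc (kendall w v)
    kendall-step {u} {w} v (i , j , adj , w≈) =
      Sum.[ (λ e → bound e w≈)
          -- An edge running backwards along the path gives the same transposition with its ends
          -- exchanged.
          , (λ e → bound e (λ x → trans (w≈ x) (cong (u ⟨$⟩ʳ_) (transpose-comm i j x)))) ] (to adj)
      where
      bound : ∀ {i j} → toℕ (σ ⟨$⟩ʳ j) ≡ suc (toℕ (σ ⟨$⟩ʳ i)) → w Perm.≈ u · transpose i j →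
        kendall u v ≤ suc (kendall w v)
      bound e w≈ = ≤-trans (m≤m+n _ _) (≤-trans (≤-reflexive (sym (kendall-swap {u} {w} v e w≈)))
        (≤-trans (+-monoʳ-≤ (kendall w v) (χ≤1 (_ <? _))) (≤-reflexive (+-comm _ 1))))

    kendall-≤ : ∀ {k u v} → Walk (cayleyGraph T) k u v → kendall u v ≤ k
    kendall-≤ {u = u} {v} (stop u≈v) = ≤-reflexive (kendall-cong {u} {v} u≈v)
    kendall-≤ {u = u} {v} (step {v = w} adj walk) =
      ≤-trans (kendall-step {u} {w} v adj) (s≤s (kendall-≤ walk))

    -- An adjacent inversion: the labels that `u` has at two consecutive positions occur in the
    -- opposite order in `v`.
    Descent : Permutation′ n → Permutation′ n → Fin n → Fin n → Set
    Descent u v i j = toℕ (σ ⟨$⟩ʳ j) ≡ suc (toℕ (σ ⟨$⟩ʳ i)) ×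
                      position v (u ⟨$⟩ʳ j) < position v (u ⟨$⟩ʳ i)

    descent? : ∀ u v → Dec (∃[ i ] ∃[ j ] Descent u v i j)
    descent? u v = Fin.any? λ i → Fin.any? λ j → (_ ≟ _) ×-dec (_ <? _)

    -- Send a position p to the position that `v` gives to the label found at p under `u`. Without
    -- descents this map increases at every step, so it is the identity and all labels agree.
    descent-free⇒≈ : ∀ u v → ¬ (∃[ i ] ∃[ j ] Descent u v i j) → u Perm.≈ v
    descent-free⇒≈ u v free x = trans (sym (inverseʳ v)) (cong (v ⟨$⟩ʳ_)
      (injective σ (Fin.toℕ-injective (trans (sym fσx) (rigid (σ ⟨$⟩ʳ x))))))
      where
      f : Fin n → ℕ
      f p = position v (u ⟨$⟩ʳ (σ ⟨$⟩ˡ p))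

      fσx : f (σ ⟨$⟩ʳ x) ≡ position v (u ⟨$⟩ʳ x)
      fσx = cong (λ y → position v (u ⟨$⟩ʳ y)) (inverseˡ σ)

      rigid : f ≗ toℕ
      rigid = increasing⇒toℕ f (λ p → Fin.toℕ<n _) λ p q e → ≤∧≢⇒<
        (≮⇒≥ λ fq<fp → free (_ , _ ,
          trans (cong toℕ (inverseʳ σ)) (trans e (cong (suc ∘ toℕ) (sym (inverseʳ σ)))) , fq<fp))
        (λ fp≡fq → 1+n≢n (trans (sym e) (cong toℕ (sym
          (injective (flip σ) (injective u (position-injective v fp≡fq)))))))

    -- Bubble sort: as long as a descent exists, its transposition is a step of the walk and removes
    -- exactly one inversion.
    kendall-walk : ∀ k u v → kendall u v ≡ k → Walk (cayleyGraph T) k u v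
    kendall-walk k u v e with descent? u v
    ... | no free = subst (λ k → Walk (cayleyGraph T) k u v)
      (trans (sym (kendall-cong {u} {v} u≈v)) e) (stop u≈v)
      where
      u≈v : u Perm.≈ v
      u≈v = descent-free⇒≈ u v free
    ... | yes (i , j , adj , desc) = sort k e
      where
      w : Permutation′ n
      w = u · transpose i j

      shorter : suc (kendall w v) ≡ kendall u v
      shorter = begin
        suc (kendall w v)    ≡⟨ +-comm 1 _ ⟩
        kendall w v ⊕ 1      ≡⟨ cong (kendall w v ⊕_) (sym (χ-true (_ <? _) desc)) ⟩
        kendall w v ⊕ _      ≡⟨ kendall-swap {u} {w} v adj (λ _ → refl) ⟩
        kendall u v ⊕ _      ≡⟨ cong (kendall u v ⊕_) (χ-false (_ <? _) (<-asym desc)) ⟩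
        kendall u v ⊕ 0      ≡⟨ +-identityʳ _ ⟩
        kendall u v          ∎
        where open ≡-Reasoning

      sort : ∀ k → kendall u v ≡ k → Walk (cayleyGraph T) k u v
      sort zero    e = ⊥-elim (1+n≢0 (trans shorter e))
      sort (suc k) e = step {v = w} (i , j , from (inj₁ adj) , λ _ → refl)
        (kendall-walk k w v (suc-injective (trans shorter e)))

    kendall-isDist : ∀ u v → IsDist (cayleyGraph T) u v (kendall u v)
    kendall-isDist u v = kendall-walk _ u v refl , λ _ → kendall-≤

    pairs-isDiameter : IsDiameter (cayleyGraph T) (pairs n)
    pairs-isDiameter =
      (Perm.id , reversal ,
        subst (IsDist (cayleyGraph T) Perm.id reversal) kendall-reversal (kendall-isDist Perm.id reversal)) ,
      λ u v → kendall u v , kendall-isDist u v , kendall≤pairs u v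

-- Passage to the integers

private
  rearrange : ∀ a b d → (a - b) + d ≡ (a + d) - b
  rearrange = ℤ.solve-∀

  cancel : ∀ a b → (a + b) - a ≡ b
  cancel = ℤ.solve-∀

shift-≡ : ∀ {c n d m} → c ⊕ d ≡ n ⊕ m → (+ c - + n) + + d ≡ + m
shift-≡ {c} {n} {d} {m} e = trans (rearrange (+ c) (+ n) (+ d))
  (trans (cong (λ s → + s - + n) e) (cancel (+ n) (+ m)))

shift-≤ : ∀ {c n d m} → c ⊕ d ≤ n ⊕ m → (+ c - + n) + + d ℤ.≤ + m
shift-≤ {c} {n} {d} {m} c+d≤n+m = subst₂ ℤ._≤_ (sym (rearrange (+ c) (+ n) (+ d))) (cancel (+ n) (+ m))
  (ℤ.+-monoˡ-≤ (ℤ.- (+ n)) (ℤ.+≤+ c+d≤n+m))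

theorem8 : ∀ (n : ℕ) → 5 ≤ n → (T : Graph n) → IsPath T →
  Σ[ distT ∈ (Fin n → Fin n → ℕ) ]
    (∀ i j → IsDist T i j (distT i j)) ×
    (∃[ diam ]
      IsDiameter (cayleyGraph T) diam ×
      IsMaximum
        (λ (π : Permutation′ n) →
          (+ cycleCount π - + n) + + (∑[ i < n ] distT i (π ⟨$⟩ʳ i)))
        (+ diam))
theorem8 n _ T (σ , iso) =
  pathDist σ , pathDist-isDist σ T iso ,
  pairs n , pairs-isDiameter σ T iso ,
  (reversal σ , shift-≡ (cycleCount+displacement-reversal σ)) ,
  λ π → shift-≤ (cycleCount+displacement≤ σ π)
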